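{- Let $k\ge 2$ and let $\mathcal{L}=\{l_1,l_2,\dots,l_s\}$ be a set of $s$ nonnegative integers with $l_1<l_2<\dots<l_s$. Suppose that $\mathcal{A}=\{A_1,\dots,A_m\}$ is a family of (distinct) subsets of $[n]$ such that $|A_{i_1}\cap A_{i_2}\cap\dots\cap A_{i_k}|\in\mathcal{L}$ for every collection of $k$ distinct subsets in $\mathcal{A}$. Let $h$ be the maximum subset size in $\mathcal{A}$. If $n\ge\left[\binom{h^2+h}{l_1+1}+1\right]s+l_1$, then \[ m\le (k-1)\left[\binom{n-l_1}{s}+\binom{n-l_1}{s-1}+\cdots+\binom{n-l_1}{0}\right]. \]
   Context: $\binom{a}{b}$ denotes the usual binomial coefficient. -}

module Defs where

open import Data.Nat using (ℕ; zero; suc; _+_; _⊔_)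
open import Data.Nat.Combinatorics using (_C_)
open import Data.Fin using (Fin; zero; suc)
open import Data.Fin.Subset using (Subset; ∣_∣; ⋂)
open import Data.List using (tabulate)
open import Function using (_∘_)

interOf : ∀ {n m k} → (Fin m → Subset n) → (Fin k → Fin m) → Subset n
interOf A f = ⋂ (tabulate (A ∘ f))

maxSize : ∀ {n m} → (Fin m → Subset n) → ℕ
maxSize {m = zero}  A = 0
maxSize {m = suc m} A = ∣ A zero ∣ ⊔ maxSize (A ∘ suc)

binomSum : ℕ → ℕ → ℕ
binomSum N zero    = N C 0
binomSum N (suc s) = N C suc s + binomSum N s

{-# OPTIONS --safe #-}
-- If all the A i share an l₁-set T, the polynomial method for k-wise intersections applies on the
-- complement of T: peel off at most k − 1 sets at a time, each time with a polynomial of degree ≤ s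
-- that vanishes at all later sets but not at one of the removed ones. The chosen sets form a
-- triangular system, so there are at most Σ_{i ≤ s} C(n − l₁, i) of them.
-- Otherwise at most h + 1 of the A i already meet in fewer than l₁ points, and their union Y, of
-- size ≤ h² + h, meets every A i in more than l₁ points. So the subfamilies of the sets containing
-- a given (l₁ + 1)-subset of Y cover everything; each has only the s − 1 intersection sizes above
-- l₁, and the lower bound on n absorbs their number C(h² + h, l₁ + 1).
module Submission where

open import Defs
open import Data.Nat using (ℕ; suc; _+_; _*_; _∸_; _≤_; _<_)
open import Data.Nat.Combinatorics using (_C_)
open import Data.Fin using (Fin; zero)
open import Data.Fin.Subset using (Subset; ∣_∣)
open import Data.Product using (∃)
open import Function.Definitions using (Injective)
open import Relation.Binary.PropositionalEquality using (_≡_)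

open import Data.Bool using (if_then_else_)
open import Data.Fin using (suc; punchIn; fromℕ<)
open import Data.Fin.Properties using (any?; all?; suc-injective)
open import Data.Fin.Subset using (⊥; ⊤; ⁅_⁆; ∁; ⋃; _∩_; _∪_; _─_; _∈_; _∉_; _⊆_; Nonempty; inside; outside)
open import Data.Fin.Subset.Properties
import Data.Integer as ℤ
open import Data.Integer using (ℤ; 0ℤ; 1ℤ) renaming (+_ to pos)
import Data.Integer.Properties as ℤ
import Data.Integer.Tactic.RingSolver as ℤ-Solver
open import Data.List using (List; []; _∷_; length; map; _++_; lookup; filter; tabulate)
open import Data.List.Membership.DecPropositional Data.Nat._≟_ using () renaming (_∈?_ to _∈ˡ?_)
open import Data.List.Membership.Propositional using () renaming (_∈_ to _∈ˡ_)
open import Data.List.Membership.Propositional.Properties using (∈-map⁺; ∈-++⁺ˡ; ∈-++⁺ʳ; ∈-filter⁺; ∈-lookup; ∈-tabulate⁺)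
open import Data.List.Properties using (length-map; length-++; length-filter; length-tabulate)
open import Data.List.Relation.Unary.All as All using (All; []; _∷_)
import Data.List.Relation.Unary.All.Properties as All
open import Data.List.Relation.Unary.Any using (here; there; index)
open import Data.List.Relation.Unary.Any.Properties using (lookup-index)
import Data.Nat as ℕ
open import Data.Nat using (zero; _≟_; z≤n; s≤s; s≤s⁻¹; s<s⁻¹)
open import Data.Nat.Combinatorics using (nC1≡n; k>n⇒nCk≡0; nCk+nC[k+1]≡[n+1]C[k+1])
import Data.Nat.Properties as ℕ
import Data.Nat.Tactic.RingSolver as ℕ-Solver
open import Data.Product using (Σ; _×_; _,_; proj₁; proj₂)
open import Data.Sum using ([_,_]′; inj₁; inj₂)
open import Data.Vec as Vec using ([]; _∷_; here; there)
open import Data.Vec.Functional using (insertAt)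
open import Data.Vec.Functional.Properties using (insertAt-lookup; insertAt-punchIn)
open import Data.Vec.Properties using ([]=⇒lookup; lookup⇒[]=; lookup∘tabulate)
open import Function using (_∘_; _$_)
open import Relation.Binary.PropositionalEquality using (_≢_; refl; sym; trans; cong; cong₂; subst; module ≡-Reasoning)
open import Relation.Nullary using (¬_; ¬?; yes; no; Dec; does; contradiction; _×-dec_; _→-dec_)
open import Relation.Nullary.Decidable using (dec-true; dec-false; decidable-stable)
open import Relation.Unary using (Pred; Decidable)
open import Algebra.Properties.CommutativeMonoid.Sum ℤ.+-0-commutativeMonoid using (sum; sum-cong-≗; sum-remove; sum-replicate-zero; ∑-comm; ∑-distrib-+)
open import Algebra.Properties.Semiring.Sum ℤ.+-*-semiring using (*-distribˡ-sum; *-distribʳ-sum)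

-- Linear algebra over ℤ: more vectors than coordinates are dependent

sum-zero : ∀ {r} {f : Fin r → ℤ} → (∀ j → f j ≡ 0ℤ) → sum f ≡ 0ℤ
sum-zero {r} f≗0 = trans (sum-cong-≗ f≗0) (sum-replicate-zero r)

-- Gaussian elimination on the first coordinate, without division. If all first entries vanish, that
-- coordinate is dropped. Otherwise a pivot `v p` with first entry `c` eliminates it from the other
-- vectors after these are scaled by `c`, and a relation among the results lifts back because `c` is
-- nonzero.
nullVector : ∀ D {r} → D < r → (v : Fin r → Fin D → ℤ) →
  ∃ λ (μ : Fin r → ℤ) → (∃ λ j → μ j ≢ 0ℤ) × (∀ d → sum (λ j → μ j ℤ.* v j d) ≡ 0ℤ)
nullVector zero (s≤s _) v = (λ _ → 1ℤ) , (zero , λ ()) , λ ()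
nullVector (suc D) {suc r} D<r v with any? (λ j → ¬? (v j zero ℤ.≟ 0ℤ))
... | no all0 =
  let μ , nz , μ⊥v = nullVector D (ℕ.<-trans (ℕ.n<1+n D) D<r) (λ j d → v j (suc d))
  in μ , nz , λ where
    zero → sum-zero λ j → trans
      (cong (μ j ℤ.*_) (decidable-stable (v j zero ℤ.≟ 0ℤ) λ v≢0 → all0 (j , v≢0)))
      (ℤ.*-zeroʳ (μ j))
    (suc d) → μ⊥v d
... | yes (p , c≢0) = ν , (punchIn p j₀ , ν≢0) , λ d → trans (expand d) (μ⊥w d)
  where
  c = v p zero
  v′ : Fin r → Fin (suc D) → ℤ
  v′ j = v (punchIn p j)
  w : Fin r → Fin (suc D) → ℤ
  w j d = c ℤ.* v′ j d ℤ.+ ℤ.- (v′ j zero ℤ.* v p d)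
  ih = nullVector D (s<s⁻¹ D<r) (λ j d → w j (suc d))
  μ = proj₁ ih
  j₀ = proj₁ (proj₁ (proj₂ ih))
  ν₀ : Fin r → ℤ
  ν₀ j = c ℤ.* μ j
  -- The pivot's coefficient gathers the multiples of `v p` subtracted in the `w j`, so that the
  -- ν-combination of the `v j` equals the μ-combination of the `w j`.
  νp = ℤ.- sum (λ j → μ j ℤ.* v′ j zero)
  ν = insertAt ν₀ p νp

  ν≢0 : ν (punchIn p j₀) ≢ 0ℤ
  ν≢0 eq = [ c≢0 , proj₂ (proj₁ (proj₂ ih)) ]′
    (ℤ.i*j≡0⇒i≡0∨j≡0 c (trans (sym (insertAt-punchIn ν₀ p νp j₀)) eq))

  μ⊥w : ∀ d → sum (λ j → μ j ℤ.* w j d) ≡ 0ℤ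
  μ⊥w zero    = sum-zero λ j → cancel (μ j) c (v′ j zero)
    where
    cancel : ∀ m c x → m ℤ.* (c ℤ.* x ℤ.+ ℤ.- (x ℤ.* c)) ≡ 0ℤ
    cancel = ℤ-Solver.solve-∀
  μ⊥w (suc d) = proj₂ (proj₂ ih) d

  expand : ∀ d → sum (λ j → ν j ℤ.* v j d) ≡ sum (λ j → μ j ℤ.* w j d)
  expand d = begin
    sum (λ j → ν j ℤ.* v j d)
      ≡⟨ sum-remove {i = p} (λ j → ν j ℤ.* v j d) ⟩
    ν p ℤ.* v p d ℤ.+ sum (λ j → ν (punchIn p j) ℤ.* v′ j d)
      ≡⟨ cong₂ ℤ._+_ (cong (ℤ._* v p d) (insertAt-lookup ν₀ p νp))
           (sum-cong-≗ λ j → cong (ℤ._* v′ j d) (insertAt-punchIn ν₀ p νp j)) ⟩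
    νp ℤ.* v p d ℤ.+ sum (λ j → ν₀ j ℤ.* v′ j d)
      ≡⟨ cong (ℤ._+ sum (λ j → ν₀ j ℤ.* v′ j d)) (swap (sum λ j → μ j ℤ.* v′ j zero) (v p d)) ⟩
    sum (λ j → μ j ℤ.* v′ j zero) ℤ.* (ℤ.- v p d) ℤ.+ sum (λ j → ν₀ j ℤ.* v′ j d)
      ≡⟨ cong (ℤ._+ sum (λ j → ν₀ j ℤ.* v′ j d)) (*-distribʳ-sum (ℤ.- v p d) (λ j → μ j ℤ.* v′ j zero)) ⟩
    sum (λ j → μ j ℤ.* v′ j zero ℤ.* (ℤ.- v p d)) ℤ.+ sum (λ j → ν₀ j ℤ.* v′ j d)
      ≡⟨ ∑-distrib-+ (λ j → μ j ℤ.* v′ j zero ℤ.* (ℤ.- v p d)) (λ j → ν₀ j ℤ.* v′ j d) ⟨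
    sum (λ j → μ j ℤ.* v′ j zero ℤ.* (ℤ.- v p d) ℤ.+ ν₀ j ℤ.* v′ j d)
      ≡⟨ sum-cong-≗ (λ j → regroup (μ j) (v′ j zero) (v p d) c (v′ j d)) ⟩
    sum (λ j → μ j ℤ.* w j d) ∎
    where
    open ≡-Reasoning
    swap : ∀ s y → (ℤ.- s) ℤ.* y ≡ s ℤ.* (ℤ.- y)
    swap = ℤ-Solver.solve-∀
    regroup : ∀ m x y c z → m ℤ.* x ℤ.* (ℤ.- y) ℤ.+ c ℤ.* m ℤ.* z ≡ m ℤ.* (c ℤ.* z ℤ.+ ℤ.- (x ℤ.* y))
    regroup = ℤ-Solver.solve-∀

-- Indicators and cardinalities

𝟙 : ∀ {p} {P : Set p} → Dec P → ℤ
𝟙 P? = if does P? then 1ℤ else 0ℤ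

𝟙-true : ∀ {p} {P : Set p} (P? : Dec P) → P → 𝟙 P? ≡ 1ℤ
𝟙-true P? p = cong (if_then 1ℤ else 0ℤ) (dec-true P? p)

𝟙-false : ∀ {p} {P : Set p} (P? : Dec P) → ¬ P → 𝟙 P? ≡ 0ℤ
𝟙-false P? ¬p = cong (if_then 1ℤ else 0ℤ) (dec-false P? ¬p)

𝟙-× : ∀ {p q r} {P : Set p} {Q : Set q} {R : Set r} (P? : Dec P) (Q? : Dec Q) (R? : Dec R) →
  (P → Q → R) → (R → P) → (R → Q) → 𝟙 P? ℤ.* 𝟙 Q? ≡ 𝟙 R?
𝟙-× (yes p) (yes q) R? to _ _  = sym (𝟙-true R? (to p q))
𝟙-× (yes _) (no ¬q) R? _ _ from = sym (𝟙-false R? (¬q ∘ from))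
𝟙-× (no ¬p) Q?      R? _ from _ = trans (ℤ.*-zeroˡ (𝟙 Q?)) (sym (𝟙-false R? (¬p ∘ from)))

∣p∣≡∑𝟙 : ∀ {n} (p : Subset n) → pos ∣ p ∣ ≡ sum (λ i → 𝟙 (i ∈? p))
∣p∣≡∑𝟙 []            = refl
∣p∣≡∑𝟙 (inside  ∷ p) = cong (λ z → 1ℤ ℤ.+ z) (∣p∣≡∑𝟙 p)
∣p∣≡∑𝟙 (outside ∷ p) = trans (∣p∣≡∑𝟙 p) (sym (ℤ.+-identityˡ _))

∣p∪q∣≤∣p∣+∣q∣ : ∀ {n} (p q : Subset n) → ∣ p ∪ q ∣ ≤ ∣ p ∣ + ∣ q ∣
∣p∪q∣≤∣p∣+∣q∣ []            []            = z≤n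
∣p∪q∣≤∣p∣+∣q∣ (outside ∷ p) (outside ∷ q) = ∣p∪q∣≤∣p∣+∣q∣ p q
∣p∪q∣≤∣p∣+∣q∣ (outside ∷ p) (inside  ∷ q) =
  ℕ.≤-trans (s≤s (∣p∪q∣≤∣p∣+∣q∣ p q)) (ℕ.≤-reflexive (sym (ℕ.+-suc ∣ p ∣ ∣ q ∣)))
∣p∪q∣≤∣p∣+∣q∣ (inside  ∷ p) (y ∷ q)       =
  s≤s (ℕ.≤-trans (∣p∪q∣≤∣p∣+∣q∣ p q) (ℕ.+-monoʳ-≤ ∣ p ∣ (∣p∣≤∣x∷p∣ y q)))

∣p∪⁅x⁆∣≤1+∣p∣ : ∀ {n} (p : Subset n) x → ∣ p ∪ ⁅ x ⁆ ∣ ≤ suc ∣ p ∣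
∣p∪⁅x⁆∣≤1+∣p∣ p x = begin
  ∣ p ∪ ⁅ x ⁆ ∣         ≤⟨ ∣p∪q∣≤∣p∣+∣q∣ p ⁅ x ⁆ ⟩
  ∣ p ∣ + ∣ ⁅ x ⁆ ∣   ≡⟨ cong (∣ p ∣ +_) (∣⁅x⁆∣≡1 x) ⟩
  ∣ p ∣ + 1           ≡⟨ ℕ.+-comm ∣ p ∣ 1 ⟩
  suc ∣ p ∣             ∎
  where open ℕ.≤-Reasoning

∪-lub : ∀ {n} {p q r : Subset n} → p ⊆ r → q ⊆ r → p ∪ q ⊆ r
∪-lub {p = p} {q} p⊆r q⊆r = [ p⊆r , q⊆r ]′ ∘ x∈p∪q⁻ p q

⁅x⁆⊆p : ∀ {n x} {p : Subset n} → x ∈ p → ⁅ x ⁆ ⊆ p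
⁅x⁆⊆p {x = x} {p} x∈p y∈⁅x⁆ = subst (_∈ p) (sym (x∈⁅y⁆⇒x≡y x y∈⁅x⁆)) x∈p

-- Multilinear polynomials on the cube

-- The multilinear monomial with variable set `S`, evaluated at the characteristic vector of `a`.
χ : ∀ {n} → Subset n → Subset n → ℤ
χ S a = 𝟙 (S ⊆? a)

-- Polynomials of degree at most `s`, as functions on the cube. `lin` takes its equation pointwise,
-- so that a function given by any formula can be recognised as a polynomial without function
-- extensionality.
data Poly {n} (s : ℕ) : (Subset n → ℤ) → Set where
  mono : ∀ S → ∣ S ∣ ≤ s → Poly s (χ S)
  lin  : ∀ {q f} (c : Fin q → ℤ) (g : Fin q → Subset n → ℤ) → (∀ i → Poly s (g i)) →
         (∀ a → f a ≡ sum (λ i → c i ℤ.* g i a)) → Poly s f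

Poly-≤ : ∀ {n s s′} {f : Subset n → ℤ} → s ≤ s′ → Poly s f → Poly s′ f
Poly-≤ s≤s′ (mono S S≤s)   = mono S (ℕ.≤-trans S≤s s≤s′)
Poly-≤ s≤s′ (lin c g Pg f≗) = lin c g (Poly-≤ s≤s′ ∘ Pg) f≗

-- The size of `a ∩ b` is the sum of the coordinates of `a` indexed by `b`. On 0/1 vectors a squared
-- variable equals itself, so multiplying `χ S` by variable i gives `χ (S ∪ ⁅ i ⁆)`, and the degree
-- grows by at most one.
Poly-χ* : ∀ {n s} (b : Subset n) (l : ℕ) S → ∣ S ∣ ≤ s →
  Poly (suc s) (λ a → χ S a ℤ.* (pos ∣ a ∩ b ∣ ℤ.- pos l))
Poly-χ* {n} {s} b l S S≤s = lin c g Pg eq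
  where
  -- Index `zero` carries the constant -l, index `suc i` the variable i.
  c : Fin (suc n) → ℤ
  c zero    = ℤ.- pos l
  c (suc i) = 𝟙 (i ∈? b)
  g : Fin (suc n) → Subset n → ℤ
  g zero    = χ S
  g (suc i) = χ (S ∪ ⁅ i ⁆)
  Pg : ∀ i → Poly (suc s) (g i)
  Pg zero    = mono S (ℕ.m≤n⇒m≤1+n S≤s)
  Pg (suc i) = mono (S ∪ ⁅ i ⁆) (ℕ.≤-trans (∣p∪⁅x⁆∣≤1+∣p∣ S i) (s≤s S≤s))
  eq : ∀ a → χ S a ℤ.* (pos ∣ a ∩ b ∣ ℤ.- pos l) ≡ sum (λ i → c i ℤ.* g i a)
  eq a = begin
    χ S a ℤ.* (pos ∣ a ∩ b ∣ ℤ.- pos l)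
      ≡⟨ distrib (χ S a) (pos ∣ a ∩ b ∣) (ℤ.- pos l) ⟩
    ℤ.- pos l ℤ.* χ S a ℤ.+ χ S a ℤ.* pos ∣ a ∩ b ∣
      ≡⟨ cong (λ z → ℤ.- pos l ℤ.* χ S a ℤ.+ χ S a ℤ.* z) (∣p∣≡∑𝟙 (a ∩ b)) ⟩
    ℤ.- pos l ℤ.* χ S a ℤ.+ χ S a ℤ.* sum (λ i → 𝟙 (i ∈? (a ∩ b)))
      ≡⟨ cong (λ z → ℤ.- pos l ℤ.* χ S a ℤ.+ z) (*-distribˡ-sum (χ S a) (λ i → 𝟙 (i ∈? (a ∩ b)))) ⟩
    ℤ.- pos l ℤ.* χ S a ℤ.+ sum (λ i → χ S a ℤ.* 𝟙 (i ∈? (a ∩ b)))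
      ≡⟨ cong (λ z → ℤ.- pos l ℤ.* χ S a ℤ.+ z) (sum-cong-≗ term) ⟩
    sum (λ i → c i ℤ.* g i a) ∎
    where
    open ≡-Reasoning
    distrib : ∀ x y z → x ℤ.* (y ℤ.+ z) ≡ z ℤ.* x ℤ.+ x ℤ.* y
    distrib = ℤ-Solver.solve-∀
    rotate : ∀ x y z → x ℤ.* (y ℤ.* z) ≡ z ℤ.* (x ℤ.* y)
    rotate = ℤ-Solver.solve-∀
    term : ∀ i → χ S a ℤ.* 𝟙 (i ∈? (a ∩ b)) ≡ 𝟙 (i ∈? b) ℤ.* χ (S ∪ ⁅ i ⁆) a
    term i = begin
      χ S a ℤ.* 𝟙 (i ∈? (a ∩ b))
        ≡⟨ cong (χ S a ℤ.*_) (𝟙-× (i ∈? a) (i ∈? b) (i ∈? (a ∩ b))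
             (λ i∈a i∈b → x∈p∩q⁺ (i∈a , i∈b)) (p∩q⊆p a b) (p∩q⊆q a b)) ⟨
      χ S a ℤ.* (𝟙 (i ∈? a) ℤ.* 𝟙 (i ∈? b))
        ≡⟨ rotate (χ S a) (𝟙 (i ∈? a)) (𝟙 (i ∈? b)) ⟩
      𝟙 (i ∈? b) ℤ.* (χ S a ℤ.* 𝟙 (i ∈? a))
        ≡⟨ cong (𝟙 (i ∈? b) ℤ.*_) (𝟙-× (S ⊆? a) (i ∈? a) (S ∪ ⁅ i ⁆ ⊆? a)
             (λ S⊆a i∈a → ∪-lub S⊆a (⁅x⁆⊆p i∈a))
             (λ Si⊆a → Si⊆a ∘ p⊆p∪q ⁅ i ⁆)
             (λ Si⊆a → Si⊆a (q⊆p∪q S ⁅ i ⁆ (x∈⁅x⁆ i)))) ⟩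
      𝟙 (i ∈? b) ℤ.* χ (S ∪ ⁅ i ⁆) a ∎

Poly-* : ∀ {n s} (b : Subset n) (l : ℕ) {f} → Poly s f →
  Poly (suc s) (λ a → f a ℤ.* (pos ∣ a ∩ b ∣ ℤ.- pos l))
Poly-* b l (mono S S≤s) = Poly-χ* b l S S≤s
Poly-* b l {f} (lin c g Pg f≗) =
  lin c (λ i a → g i a ℤ.* factor a) (λ i → Poly-* b l (Pg i)) λ a → begin
    f a ℤ.* factor a                             ≡⟨ cong (ℤ._* factor a) (f≗ a) ⟩
    sum (λ i → c i ℤ.* g i a) ℤ.* factor a       ≡⟨ *-distribʳ-sum (factor a) (λ i → c i ℤ.* g i a) ⟩
    sum (λ i → c i ℤ.* g i a ℤ.* factor a)       ≡⟨ sum-cong-≗ (λ i → ℤ.*-assoc (c i) (g i a) (factor a)) ⟩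
    sum (λ i → c i ℤ.* (g i a ℤ.* factor a))     ∎
  where
  open ≡-Reasoning
  factor : Subset _ → ℤ
  factor a = pos ∣ a ∩ b ∣ ℤ.- pos l

-- Polynomials separating supersets of a given set

-- The product of the linear forms `∣ a ∩ b ∣` - l. The empty product is written `χ ⊥`, the constant
-- 1 as a monomial.
∏∣∩∣- : ∀ {n} → Subset n → List ℕ → Subset n → ℤ
∏∣∩∣- b []       a = χ ⊥ a
∏∣∩∣- b (l ∷ ls) a = ∏∣∩∣- b ls a ℤ.* (pos ∣ a ∩ b ∣ ℤ.- pos l)

∏-Poly : ∀ {n} (b : Subset n) ls → Poly (length ls) (∏∣∩∣- b ls)
∏-Poly {n} b []       = mono ⊥ (ℕ.≤-reflexive (∣⊥∣≡0 n))
∏-Poly b (l ∷ ls) = Poly-* b l (∏-Poly b ls)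

∏≢0 : ∀ {n} (b : Subset n) ls a → All (_≢ ∣ a ∩ b ∣) ls → ∏∣∩∣- b ls a ≢ 0ℤ
∏≢0 b []       a []         eq = contradiction (trans (sym (𝟙-true (⊥ ⊆? a) ⊥⊆)) eq) λ ()
∏≢0 b (l ∷ ls) a (l≢ ∷ ls≢) eq with ℤ.i*j≡0⇒i≡0∨j≡0 (∏∣∩∣- b ls a) eq
... | inj₁ ∏≡0 = ∏≢0 b ls a ls≢ ∏≡0
... | inj₂ f≡0 = l≢ (sym (ℤ.+-injective (ℤ.i-j≡0⇒i≡j (pos ∣ a ∩ b ∣) (pos l) f≡0)))

∏≡0 : ∀ {n} (b : Subset n) ls a → ∣ a ∩ b ∣ ∈ˡ ls → ∏∣∩∣- b ls a ≡ 0ℤ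
∏≡0 b (l ∷ ls) a (here eq)  = trans
  (cong (∏∣∩∣- b ls a ℤ.*_) (ℤ.i≡j⇒i-j≡0 (cong pos eq)))
  (ℤ.*-zeroʳ (∏∣∩∣- b ls a))
∏≡0 b (l ∷ ls) a (there ∈ls) = cong (ℤ._* (pos ∣ a ∩ b ∣ ℤ.- pos l)) (∏≡0 b ls a ∈ls)

_without_ : List ℕ → ℕ → List ℕ
ls without q = filter (λ l → ¬? (l ≟ q)) ls

-- Omitting the factor at ∣ b ∣ keeps the value at the supersets of b nonzero even when ∣ b ∣ is an
-- admissible size.
separator : ∀ {n} → Subset n → List ℕ → Subset n → ℤ
separator b ls = ∏∣∩∣- b (ls without ∣ b ∣)

separator-Poly : ∀ {n} (b : Subset n) ls → Poly (length ls) (separator b ls)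
separator-Poly b ls = Poly-≤ (length-filter (λ l → ¬? (l ≟ ∣ b ∣)) ls) (∏-Poly b (ls without ∣ b ∣))

-- For `a` above `b` the intersection is `b` itself, and no remaining factor has its root at
-- `∣ b ∣`.
separator≢0 : ∀ {n} (b : Subset n) ls {a} → b ⊆ a → separator b ls a ≢ 0ℤ
separator≢0 b ls {a} b⊆a = ∏≢0 b _ a
  (subst (λ z → All (_≢ z) (ls without ∣ b ∣)) (cong ∣_∣ (sym a∩b≡b))
    (All.all-filter (λ l → ¬? (l ≟ ∣ b ∣)) ls))
  where
  a∩b≡b : a ∩ b ≡ b
  a∩b≡b = ⊆-antisym (p∩q⊆q a b) (λ x∈b → x∈p∩q⁺ (b⊆a x∈b , x∈b))

separator≡0 : ∀ {n} (b : Subset n) ls {a} → ∣ a ∩ b ∣ ∈ˡ ls → ∣ a ∩ b ∣ ≢ ∣ b ∣ → separator b ls a ≡ 0ℤ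
separator≡0 b ls {a} ∈ls ≢b = ∏≡0 b _ a (∈-filter⁺ (λ l → ¬? (l ≟ ∣ b ∣)) ∈ls ≢b)

-- Triangular systems and linear independence

-- A linear relation among the evaluations at the points `a j`, tested on monomials only;
-- `kills-Poly` extends it to all polynomials of degree at most `s`.
Kills : ∀ {n r} → ℕ → (Fin r → ℤ) → (Fin r → Subset n) → Set
Kills s μ a = ∀ S → ∣ S ∣ ≤ s → sum (λ j → μ j ℤ.* χ S (a j)) ≡ 0ℤ

kills-Poly : ∀ {n r s} (μ : Fin r → ℤ) (a : Fin r → Subset n) → Kills s μ a →
  ∀ {f} → Poly s f → sum (λ j → μ j ℤ.* f (a j)) ≡ 0ℤ
kills-Poly μ a kills (mono S S≤s) = kills S S≤s
kills-Poly μ a kills {f} (lin c g Pg f≗) = begin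
  sum (λ j → μ j ℤ.* f (a j))
    ≡⟨ sum-cong-≗ (λ j → trans (cong (μ j ℤ.*_) (f≗ (a j))) (*-distribˡ-sum (μ j) (λ i → c i ℤ.* g i (a j)))) ⟩
  sum (λ j → sum (λ i → μ j ℤ.* (c i ℤ.* g i (a j))))
    ≡⟨ ∑-comm (λ j i → μ j ℤ.* (c i ℤ.* g i (a j))) ⟩
  sum (λ i → sum (λ j → μ j ℤ.* (c i ℤ.* g i (a j))))
    ≡⟨ sum-zero (λ i → begin
      sum (λ j → μ j ℤ.* (c i ℤ.* g i (a j)))   ≡⟨ sum-cong-≗ (λ j → swap (μ j) (c i) (g i (a j))) ⟩
      sum (λ j → c i ℤ.* (μ j ℤ.* g i (a j)))   ≡⟨ *-distribˡ-sum (c i) (λ j → μ j ℤ.* g i (a j)) ⟨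
      c i ℤ.* sum (λ j → μ j ℤ.* g i (a j))     ≡⟨ cong (c i ℤ.*_) (kills-Poly μ a kills (Pg i)) ⟩
      c i ℤ.* 0ℤ                                ≡⟨ ℤ.*-zeroʳ (c i) ⟩
      0ℤ                                        ∎) ⟩
  0ℤ ∎
  where
  open ≡-Reasoning
  swap : ∀ x y z → x ℤ.* (y ℤ.* z) ≡ y ℤ.* (x ℤ.* z)
  swap = ℤ-Solver.solve-∀

data Triangular {n} (s : ℕ) : ∀ {r} → (Fin r → Subset n) → Set where
  []   : ∀ {a : Fin 0 → Subset n} → Triangular s a
  cons : ∀ {r} {a : Fin (suc r) → Subset n} f → Poly s f → f (a zero) ≢ 0ℤ →
         (∀ j → f (a (suc j)) ≡ 0ℤ) → Triangular s (a ∘ suc) → Triangular s a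

-- Applying the relation to the first polynomial leaves only its value at the first point, which is
-- nonzero, so the first coefficient vanishes. What remains is a relation for the tail.
Triangular-independent : ∀ {n s r} {a : Fin r → Subset n} → Triangular s a →
  (μ : Fin r → ℤ) → Kills s μ a → ∀ j → μ j ≡ 0ℤ
Triangular-independent {a = a} (cons f Pf f₀≢0 f≡0 tri) μ kills = go
  where
  open ≡-Reasoning
  μ₀f₀≡0 : μ zero ℤ.* f (a zero) ≡ 0ℤ
  μ₀f₀≡0 = begin
    μ zero ℤ.* f (a zero)
      ≡⟨ ℤ.+-identityʳ _ ⟨
    μ zero ℤ.* f (a zero) ℤ.+ 0ℤ
      ≡⟨ cong (λ z → μ zero ℤ.* f (a zero) ℤ.+ z)
           (sum-zero λ j → trans (cong (μ (suc j) ℤ.*_) (f≡0 j)) (ℤ.*-zeroʳ (μ (suc j)))) ⟨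
    sum (λ j → μ j ℤ.* f (a j))
      ≡⟨ kills-Poly μ a kills Pf ⟩
    0ℤ ∎
  μ₀≡0 : μ zero ≡ 0ℤ
  μ₀≡0 = [ (λ eq → eq) , (λ f₀≡0 → contradiction f₀≡0 f₀≢0) ]′ (ℤ.i*j≡0⇒i≡0∨j≡0 (μ zero) μ₀f₀≡0)
  kills′ : Kills _ (μ ∘ suc) (a ∘ suc)
  kills′ S S≤s = begin
    sum (λ j → μ (suc j) ℤ.* χ S (a (suc j)))
      ≡⟨ ℤ.+-identityˡ _ ⟨
    0ℤ ℤ.+ sum (λ j → μ (suc j) ℤ.* χ S (a (suc j)))
      ≡⟨ cong (λ z → z ℤ.* χ S (a zero) ℤ.+ sum (λ j → μ (suc j) ℤ.* χ S (a (suc j)))) μ₀≡0 ⟨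
    sum (λ j → μ j ℤ.* χ S (a j))
      ≡⟨ kills S S≤s ⟩
    0ℤ ∎
  go : ∀ j → μ j ≡ 0ℤ
  go zero    = μ₀≡0
  go (suc j) = Triangular-independent tri (μ ∘ suc) kills′ j

-- Listing and counting the monomials

subsetsOfSize : ∀ {n} → ℕ → Subset n → List (Subset n)
subsetsOfSize zero    []            = [] ∷ []
subsetsOfSize (suc q) []            = []
subsetsOfSize q       (outside ∷ p) = map (outside ∷_) (subsetsOfSize q p)
subsetsOfSize zero    (inside ∷ p)  = map (outside ∷_) (subsetsOfSize zero p)
subsetsOfSize (suc q) (inside ∷ p)  =
  map (inside ∷_) (subsetsOfSize q p) ++ map (outside ∷_) (subsetsOfSize (suc q) p)

length-subsetsOfSize : ∀ {n} q (p : Subset n) → length (subsetsOfSize q p) ≡ ∣ p ∣ C q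
length-subsetsOfSize zero    []            = refl
length-subsetsOfSize (suc q) []            = refl
length-subsetsOfSize zero    (outside ∷ p) =
  trans (length-map (outside ∷_) (subsetsOfSize zero p)) (length-subsetsOfSize zero p)
length-subsetsOfSize (suc q) (outside ∷ p) =
  trans (length-map (outside ∷_) (subsetsOfSize (suc q) p)) (length-subsetsOfSize (suc q) p)
length-subsetsOfSize zero    (inside ∷ p)  =
  trans (length-map (outside ∷_) (subsetsOfSize zero p)) (length-subsetsOfSize zero p)
length-subsetsOfSize (suc q) (inside ∷ p)  = begin
  length (map (inside ∷_) (subsetsOfSize q p) ++ map (outside ∷_) (subsetsOfSize (suc q) p))
    ≡⟨ length-++ (map (inside ∷_) (subsetsOfSize q p)) ⟩
  length (map (inside ∷_) (subsetsOfSize q p)) + length (map (outside ∷_) (subsetsOfSize (suc q) p))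
    ≡⟨ cong₂ _+_
         (trans (length-map (inside ∷_) (subsetsOfSize q p)) (length-subsetsOfSize q p))
         (trans (length-map (outside ∷_) (subsetsOfSize (suc q) p)) (length-subsetsOfSize (suc q) p)) ⟩
  ∣ p ∣ C q + ∣ p ∣ C suc q
    ≡⟨ nCk+nC[k+1]≡[n+1]C[k+1] ∣ p ∣ q ⟩
  suc ∣ p ∣ C suc q ∎
  where open ≡-Reasoning

∈-subsetsOfSize : ∀ {n} {S p : Subset n} → S ⊆ p → S ∈ˡ subsetsOfSize ∣ S ∣ p
∈-subsetsOfSize {S = []}          {[]}          _   = here refl
-- `subsetsOfSize` splits on its size argument first, so it reduces only after `∣ S ∣` has been
-- exposed as `zero` or `suc`.
∈-subsetsOfSize {S = outside ∷ S} {outside ∷ p} S⊆p with ∣ S ∣ | ∈-subsetsOfSize (drop-∷-⊆ S⊆p)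
... | zero  | S∈ = ∈-map⁺ (outside ∷_) S∈
... | suc _ | S∈ = ∈-map⁺ (outside ∷_) S∈
∈-subsetsOfSize {S = outside ∷ S} {inside ∷ p}  S⊆p
  with ∣ S ∣ | ∈-subsetsOfSize {S = S} {p} (λ x∈S → drop-there (S⊆p (there x∈S)))
... | zero  | S∈ = ∈-map⁺ (outside ∷_) S∈
... | suc q | S∈ = ∈-++⁺ʳ (map (inside ∷_) (subsetsOfSize q p)) (∈-map⁺ (outside ∷_) S∈)
∈-subsetsOfSize {S = inside ∷ S}  {outside ∷ p} S⊆p = contradiction (S⊆p here) λ ()
∈-subsetsOfSize {S = inside ∷ S}  {inside ∷ p}  S⊆p =
  ∈-++⁺ˡ (∈-map⁺ (inside ∷_) (∈-subsetsOfSize (drop-∷-⊆ S⊆p)))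

subsetsUpTo : ∀ {n} → ℕ → Subset n → List (Subset n)
subsetsUpTo zero    p = subsetsOfSize zero p
subsetsUpTo (suc s) p = subsetsOfSize (suc s) p ++ subsetsUpTo s p

length-subsetsUpTo : ∀ {n} s (p : Subset n) → length (subsetsUpTo s p) ≡ binomSum ∣ p ∣ s
length-subsetsUpTo zero    p = length-subsetsOfSize zero p
length-subsetsUpTo (suc s) p = trans (length-++ (subsetsOfSize (suc s) p))
  (cong₂ _+_ (length-subsetsOfSize (suc s) p) (length-subsetsUpTo s p))

∈-subsetsUpTo : ∀ {n} s {S p : Subset n} → ∣ S ∣ ≤ s → S ⊆ p → S ∈ˡ subsetsUpTo s p
∈-subsetsUpTo zero    {S} {p} S≤0 S⊆p =
  subst (λ q → S ∈ˡ subsetsOfSize q p) (ℕ.n≤0⇒n≡0 S≤0) (∈-subsetsOfSize S⊆p)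
∈-subsetsUpTo (suc s) {S} {p} S≤s S⊆p with ∣ S ∣ ≟ suc s
... | yes eq = ∈-++⁺ˡ (subst (λ q → S ∈ˡ subsetsOfSize q p) eq (∈-subsetsOfSize S⊆p))
... | no neq = ∈-++⁺ʳ (subsetsOfSize (suc s) p)
  (∈-subsetsUpTo s (s≤s⁻¹ (ℕ.≤∧≢⇒< S≤s neq)) S⊆p)

-- On supersets of T the monomials χ S and χ (S ∩ ∁ T) agree, so only the subsets of ∁ T count.
Triangular-bound : ∀ {n s r} (T : Subset n) {a : Fin r → Subset n} → (∀ j → T ⊆ a j) →
  Triangular s a → r ≤ binomSum ∣ ∁ T ∣ s
Triangular-bound {s = s} T {a} T⊆a tri = subst (_ ≤_) (length-subsetsUpTo s (∁ T)) $ ℕ.≮⇒≥ λ D<r →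
  let μ , (j , μj≢0) , μ⊥ = nullVector _ D<r (λ j d → χ (lookup Ss d) (a j))
  in μj≢0 (Triangular-independent tri μ (kills μ μ⊥) j)
  where
  Ss = subsetsUpTo s (∁ T)
  χ-restrict : ∀ S j → χ S (a j) ≡ χ (S ∩ ∁ T) (a j)
  χ-restrict S j with S ⊆? a j
  ... | yes S⊆a = sym (𝟙-true (S ∩ ∁ T ⊆? a j) (S⊆a ∘ p∩q⊆p S (∁ T)))
  ... | no  S⊈a = sym (𝟙-false (S ∩ ∁ T ⊆? a j) λ S∩∁T⊆a → S⊈a (inA S∩∁T⊆a))
    where
    inA : S ∩ ∁ T ⊆ a j → S ⊆ a j
    inA ⊆a {x} x∈S with x ∈? T
    ... | yes x∈T = T⊆a j x∈T
    ... | no  x∉T = ⊆a (x∈p∩q⁺ (x∈S , x∉p⇒x∈∁p x∉T))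
  kills : ∀ μ → (∀ d → sum (λ j → μ j ℤ.* χ (lookup Ss d) (a j)) ≡ ℤ.0ℤ) → Kills s μ a
  kills μ μ⊥ S S≤s = trans
    (sum-cong-≗ λ j → cong (μ j ℤ.*_) (trans (χ-restrict S j) (cong (λ S′ → χ S′ (a j)) (lookup-index S∈))))
    (μ⊥ (index S∈))
    where S∈ = ∈-subsetsUpTo s (ℕ.≤-trans (∣p∩q∣≤∣p∣ S (∁ T)) S≤s) (p∩q⊆q S (∁ T))

-- Intersections indexed by sets of indices

comprehension : ∀ {n p} {P : Pred (Fin n) p} → Decidable P → Subset n
comprehension P? = Vec.tabulate (does ∘ P?)

module _ {n p} {P : Pred (Fin n) p} (P? : Decidable P) where

  ∈-comprehension⁺ : ∀ {x} → P x → x ∈ comprehension P?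
  ∈-comprehension⁺ {x} Px = lookup⇒[]= x _ (trans (lookup∘tabulate (does ∘ P?) x) (dec-true (P? x) Px))

  ∈-comprehension⁻ : ∀ {x} → x ∈ comprehension P? → P x
  ∈-comprehension⁻ {x} x∈ with P? x | trans (sym (lookup∘tabulate (does ∘ P?) x)) ([]=⇒lookup x∈)
  ... | yes Px | _  = Px
  ... | no _   | ()

module _ {n m} (A : Fin m → Subset n) (J : Subset m) where

  private
    inAll? : Decidable (λ x → ∀ j → j ∈ J → x ∈ A j)
    inAll? x = all? λ j → (j ∈? J) →-dec (x ∈? A j)

  -- Index sets, unlike injections, can be enlarged, restricted and subtracted. The meet over the
  -- empty `J` is the whole ground set.
  meet : Subset n
  meet = comprehension inAll?

  meet⊆ : ∀ {j} → j ∈ J → meet ⊆ A j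
  meet⊆ {j} j∈J x∈ = ∈-comprehension⁻ inAll? x∈ j j∈J

  ⊆meet : ∀ {S} → (∀ {j} → j ∈ J → S ⊆ A j) → S ⊆ meet
  ⊆meet S⊆ x∈S = ∈-comprehension⁺ inAll? λ j j∈J → S⊆ j∈J x∈S

meet-antitone : ∀ {n m} (A : Fin m → Subset n) {J K} → J ⊆ K → meet A K ⊆ meet A J
meet-antitone A {J} {K} J⊆K = ⊆meet A J (meet⊆ A K ∘ J⊆K)

-- The new set stands on the left to match `∣ a ∩ b ∣` in `separator`, with `meet A J` as `b`.
meet-∪⁅⁆ : ∀ {n m} (A : Fin m → Subset n) J i → meet A (J ∪ ⁅ i ⁆) ≡ A i ∩ meet A J
meet-∪⁅⁆ A J i = ⊆-antisym
  (λ x∈ → x∈p∩q⁺ (meet⊆ A (J ∪ ⁅ i ⁆) (q⊆p∪q J ⁅ i ⁆ (x∈⁅x⁆ i)) x∈ , meet-antitone A (p⊆p∪q ⁅ i ⁆) x∈))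
  (⊆meet A (J ∪ ⁅ i ⁆) λ {j} j∈ x∈ → [ (λ j∈J → meet⊆ A J j∈J (p∩q⊆q (A i) _ x∈))
    , (λ j∈i → subst (λ j → _ ∈ A j) (sym (x∈⁅y⁆⇒x≡y i j∈i)) (p∩q⊆p (A i) _ x∈)) ]′ (x∈p∪q⁻ J ⁅ i ⁆ j∈))

meet-⁅⁆ : ∀ {n m} (A : Fin m → Subset n) i → meet A ⁅ i ⁆ ≡ A i
meet-⁅⁆ A i = ⊆-antisym (meet⊆ A ⁅ i ⁆ (x∈⁅x⁆ i))
  (⊆meet A ⁅ i ⁆ λ j∈i → subst (λ j → A i ⊆ A j) (sym (x∈⁅y⁆⇒x≡y i j∈i)) ⊆-refl)

enumerate : ∀ {m} (J : Subset m) → ∃ λ (f : Fin ∣ J ∣ → Fin m) →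
  Injective _≡_ _≡_ f × (∀ i → f i ∈ J) × (∀ {x} → x ∈ J → ∃ λ i → f i ≡ x)
enumerate []            = (λ ()) , (λ {}) , (λ ()) , λ ()
enumerate (outside ∷ J) with f , f-inj , f∈J , f-onto ← enumerate J =
  suc ∘ f , f-inj ∘ suc-injective , there ∘ f∈J ,
  λ { (there x∈J) → let i , eq = f-onto x∈J in i , cong suc eq }
enumerate (inside ∷ J)  with f , f-inj , f∈J , f-onto ← enumerate J =
  g , g-inj , g∈ , λ where
    here        → zero , refl
    (there x∈J) → let i , eq = f-onto x∈J in suc i , cong suc eq
  where
  g : Fin (suc ∣ J ∣) → Fin _
  g zero    = zero
  g (suc i) = suc (f i)
  g-inj : Injective _≡_ _≡_ g
  g-inj {zero}  {zero}  _  = refl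
  g-inj {suc i} {suc j} eq = cong suc (f-inj (suc-injective eq))
  g∈ : ∀ i → g i ∈ inside ∷ J
  g∈ zero    = here
  g∈ (suc i) = there (f∈J i)

x∈interOf⁺ : ∀ {n m} k (A : Fin m → Subset n) (f : Fin k → Fin m) {x} → (∀ i → x ∈ A (f i)) → x ∈ interOf A f
x∈interOf⁺ zero    A f x∈ = ∈⊤
x∈interOf⁺ (suc k) A f x∈ = x∈p∩q⁺ (x∈ zero , x∈interOf⁺ k A (f ∘ suc) (x∈ ∘ suc))

x∈interOf⁻ : ∀ {n m} k (A : Fin m → Subset n) (f : Fin k → Fin m) {x} → x ∈ interOf A f → ∀ i → x ∈ A (f i)
x∈interOf⁻ (suc k) A f x∈ zero    = p∩q⊆p (A (f zero)) _ x∈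
x∈interOf⁻ (suc k) A f x∈ (suc i) = x∈interOf⁻ k A (f ∘ suc) (p∩q⊆q (A (f zero)) _ x∈) i

-- Carries the hypothesis on injective k-tuples over to index sets of size k.
meet≡interOf : ∀ {n m} (A : Fin m → Subset n) J → ∃ λ (f : Fin ∣ J ∣ → Fin m) →
  Injective _≡_ _≡_ f × interOf A f ≡ meet A J
meet≡interOf A J with f , f-inj , f∈J , f-onto ← enumerate J = f , f-inj , ⊆-antisym
  (⊆meet A J λ j∈J x∈ → let i , eq = f-onto j∈J in subst (λ j → _ ∈ A j) eq (x∈interOf⁻ _ A f x∈ i))
  (λ x∈ → x∈interOf⁺ _ A f λ i → meet⊆ A J (f∈J i) x∈)

-- Maximal elements and cardinality estimates

argmax : ∀ {m} (g : Fin m → ℕ) (R : Subset m) → Nonempty R → ∃ λ i → i ∈ R × (∀ {j} → j ∈ R → g j ≤ g i)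
argmax g (s ∷ R) ne with nonempty? R
argmax g (outside ∷ R) (suc i , there i∈R) | no R≡∅ = contradiction (i , i∈R) R≡∅
argmax g (inside ∷ R)  ne | no R≡∅ = zero , here , λ where
  here        → ℕ.≤-refl
  (there j∈R) → contradiction (_ , j∈R) R≡∅
... | yes neR with argmax (g ∘ suc) R neR
argmax g (outside ∷ R) ne | yes neR | i , i∈R , max = suc i , there i∈R , λ { (there j∈R) → max j∈R }
argmax g (inside ∷ R)  ne | yes neR | i , i∈R , max with ℕ.≤-total (g zero) (g (suc i))
... | inj₁ g0≤gi = suc i , there i∈R , λ { here → g0≤gi ; (there j∈R) → max j∈R }
... | inj₂ gi≤g0 = zero , here , λ { here → ℕ.≤-refl ; (there j∈R) → ℕ.≤-trans (max j∈R) gi≤g0 }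

p⊆q∧∣q∣≤∣p∣⇒q⊆p : ∀ {n} {p q : Subset n} → p ⊆ q → ∣ q ∣ ≤ ∣ p ∣ → q ⊆ p
p⊆q∧∣q∣≤∣p∣⇒q⊆p {p = p} {q} p⊆q q≤p {x} x∈q = decidable-stable (x ∈? p) λ x∉p →
  ℕ.<⇒≱ (p⊂q⇒∣p∣<∣q∣ (p⊆q , x , x∈q , x∉p)) q≤p

x∉p⇒∣p∪⁅x⁆∣≡1+∣p∣ : ∀ {n x} {p : Subset n} → x ∉ p → ∣ p ∪ ⁅ x ⁆ ∣ ≡ suc ∣ p ∣
x∉p⇒∣p∪⁅x⁆∣≡1+∣p∣ {x = x} {p} x∉p = ℕ.≤-antisym (∣p∪⁅x⁆∣≤1+∣p∣ p x)
  (p⊂q⇒∣p∣<∣q∣ (p⊆p∪q ⁅ x ⁆ , x , q⊆p∪q p ⁅ x ⁆ (x∈⁅x⁆ x) , x∉p))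

∣p∣≤∣p─q∣+∣q∣ : ∀ {n} (p q : Subset n) → ∣ p ∣ ≤ ∣ p ─ q ∣ + ∣ q ∣
∣p∣≤∣p─q∣+∣q∣ p q = ℕ.≤-trans (p⊆q⇒∣p∣≤∣q∣ p⊆) (∣p∪q∣≤∣p∣+∣q∣ (p ─ q) q)
  where
  p⊆ : p ⊆ (p ─ q) ∪ q
  p⊆ {x} x∈p with x ∈? q
  ... | yes x∈q = q⊆p∪q (p ─ q) q x∈q
  ... | no  x∉q = p⊆p∪q q (x∈p∧x∉q⇒x∈p─q x∈p x∉q)

x∈p─q⇒x∉q : ∀ {n x} (p q : Subset n) → x ∈ p ─ q → x ∉ q
x∈p─q⇒x∉q (_ ∷ p) (inside ∷ q)  (there x∈) (there x∈q) = x∈p─q⇒x∉q p q x∈ x∈q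
x∈p─q⇒x∉q (_ ∷ p) (outside ∷ q) (there x∈) (there x∈q) = x∈p─q⇒x∉q p q x∈ x∈q

-- Peeling off blocks of sets

module _ {n m} (A : Fin m → Subset n) (ls : List ℕ) where

  Intersecting : ℕ → Subset m → Set
  Intersecting k R = ∀ J → J ⊆ R → ∣ J ∣ ≡ k → ∣ meet A J ∣ ∈ˡ ls

  -- One round for intersection order e + 2: the block `J` of at most e + 1 indices leaves `R`, and
  -- only `i` is kept, with `f` as its row of the triangular system. `f≡0` concerns only indices
  -- outside `J`, so other members of the block are discarded.
  record Peel (e : ℕ) (R : Subset m) : Set where
    field
      J      : Subset m
      J⊆R    : J ⊆ R
      ∣J∣≤   : ∣ J ∣ ≤ suc e
      i      : Fin m
      i∈J    : i ∈ J
      f      : Subset n → ℤ.ℤ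
      f-Poly : Poly (length ls) f
      f≢0    : f (A i) ≢ ℤ.0ℤ
      f≡0    : ∀ {x} → x ∈ R → x ∉ J → f (A x) ≡ ℤ.0ℤ

  -- Lower the intersection order until some J of that order has a meet B of inadmissible size; every
  -- further A x cuts B in an admissible size, hence properly. If this never happens, all pairwise
  -- meets are admissible and a largest A i, contained in no other A x, plays the role of B.
  peel : Injective _≡_ _≡_ A → ∀ e R → Nonempty R → Intersecting (suc (suc e)) R → Peel e R
  peel A-inj zero R ne int with i , i∈R , max ← argmax (λ j → ∣ A j ∣) R ne = record
    { J      = ⁅ i ⁆
    ; J⊆R    = ⁅x⁆⊆p i∈R
    ; ∣J∣≤   = ℕ.≤-reflexive (∣⁅x⁆∣≡1 i)
    ; i      = i
    ; i∈J    = x∈⁅x⁆ i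
    ; f      = separator (A i) ls
    ; f-Poly = separator-Poly (A i) ls
    ; f≢0    = separator≢0 (A i) ls ⊆-refl
    ; f≡0    = λ {x} x∈R x∉i → separator≡0 (A i) ls
        (subst (λ S → ∣ S ∣ ∈ˡ ls)
          (trans (meet-∪⁅⁆ A ⁅ i ⁆ x) (cong (A x ∩_) (meet-⁅⁆ A i)))
          (int (⁅ i ⁆ ∪ ⁅ x ⁆) (∪-lub (⁅x⁆⊆p i∈R) (⁅x⁆⊆p x∈R))
            (trans (x∉p⇒∣p∪⁅x⁆∣≡1+∣p∣ x∉i) (cong suc (∣⁅x⁆∣≡1 i)))))
        (λ eq → x∉i (subst (_∈ ⁅ i ⁆) (A-inj (Ai≡Ax x∈R eq)) (x∈⁅x⁆ i)))
    }
    where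
    Ai≡Ax : ∀ {x} → x ∈ R → ∣ A x ∩ A i ∣ ≡ ∣ A i ∣ → A i ≡ A x
    Ai≡Ax {x} x∈R eq = ⊆-antisym Ai⊆Ax (p⊆q∧∣q∣≤∣p∣⇒q⊆p Ai⊆Ax (max x∈R))
      where
      Ai⊆Ax : A i ⊆ A x
      Ai⊆Ax = p∩q⊆p (A x) (A i) ∘ p⊆q∧∣q∣≤∣p∣⇒q⊆p (p∩q⊆q (A x) (A i)) (ℕ.≤-reflexive (sym eq))
  peel A-inj (suc e) R ne int
    with anySubset? (λ J → (J ⊆? R) ×-dec (∣ J ∣ ≟ suc (suc e)) ×-dec ¬? (∣ meet A J ∣ ∈ˡ? ls))
  ... | no ∄J = record { Peel P ; ∣J∣≤ = ℕ.m≤n⇒m≤1+n (Peel.∣J∣≤ P) }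
    where
    P = peel A-inj e R ne λ J J⊆R ∣J∣≡ →
      decidable-stable (∣ meet A J ∣ ∈ˡ? ls) λ ∉ls → ∄J (J , J⊆R , ∣J∣≡ , ∉ls)
  ... | yes (J , J⊆R , ∣J∣≡ , ∉ls) with nonempty? J
  ...   | no J≡∅ = contradiction (trans (sym ∣J∣≡) (trans (cong ∣_∣ (Empty-unique J≡∅)) (∣⊥∣≡0 m))) λ ()
  ...   | yes (i , i∈J) = record
    { J      = J
    ; J⊆R    = J⊆R
    ; ∣J∣≤   = ℕ.≤-reflexive ∣J∣≡
    ; i      = i
    ; i∈J    = i∈J
    ; f      = separator (meet A J) ls
    ; f-Poly = separator-Poly (meet A J) ls
    ; f≢0    = separator≢0 (meet A J) ls (meet⊆ A J i∈J)
    ; f≡0    = λ {x} x∈R x∉J →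
        let ∈ls = subst (λ S → ∣ S ∣ ∈ˡ ls) (meet-∪⁅⁆ A J x)
                    (int (J ∪ ⁅ x ⁆) (∪-lub J⊆R (⁅x⁆⊆p x∈R))
                      (trans (x∉p⇒∣p∪⁅x⁆∣≡1+∣p∣ x∉J) (cong suc ∣J∣≡)))
        in separator≡0 (meet A J) ls ∈ls λ eq → ∉ls (subst (_∈ˡ ls) eq ∈ls)
    }

  -- Each round adds one row and removes at most e + 1 indices, whence the factor e + 1. All later
  -- points lie in `R ─ J`, where the current `f` vanishes. `N` is a bound on `∣ R ∣` that drives
  -- the recursion.
  extract : Injective _≡_ _≡_ A → ∀ e N R → ∣ R ∣ ≤ N → Intersecting (suc (suc e)) R →
    ∃ λ r → Σ (Fin r → Fin m) λ x →
      (∀ j → x j ∈ R) × Triangular (length ls) (A ∘ x) × ∣ R ∣ ≤ suc e * r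
  extract A-inj e N R R≤N int with nonempty? R
  ... | no R≡∅ = 0 , (λ ()) , (λ ()) , [] ,
    ℕ.≤-trans (ℕ.≤-reflexive (trans (cong ∣_∣ (Empty-unique R≡∅)) (∣⊥∣≡0 m))) z≤n
  extract A-inj e zero    R R≤N int | yes (y , y∈R) =
    contradiction (ℕ.≤-trans (ℕ.≤-reflexive (sym (∣⁅x⁆∣≡1 y))) (p⊆q⇒∣p∣≤∣q∣ (⁅x⁆⊆p y∈R))) (ℕ.<⇒≱ (s≤s R≤N))
  extract A-inj e (suc N) R R≤N int | yes ne =
    let r , x , x∈R′ , tri , R′≤ = extract A-inj e N R′ R′≤N λ K K⊆R′ → int K (p─q⊆p R J ∘ K⊆R′)
    in suc r , (λ { zero → i ; (suc j) → x j })
     , (λ { zero → J⊆R i∈J ; (suc j) → p─q⊆p R J (x∈R′ j) })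
     , cons f f-Poly f≢0 (λ j → f≡0 (p─q⊆p R J (x∈R′ j)) (x∈p─q⇒x∉q R J (x∈R′ j))) tri
     , (begin
         ∣ R ∣                          ≤⟨ ∣p∣≤∣p─q∣+∣q∣ R J ⟩
         ∣ R′ ∣ + ∣ J ∣               ≤⟨ ℕ.+-mono-≤ R′≤ ∣J∣≤ ⟩
         suc e * r + suc e          ≡⟨ ℕ.+-comm (suc e * r) (suc e) ⟩
         suc e + suc e * r          ≡⟨ ℕ.*-suc (suc e) r ⟨
         suc e * suc r                ∎)
    where
    open ℕ.≤-Reasoning
    open Peel (peel A-inj e R ne int)
    R′ = R ─ J
    -- The block contains `i`, so removing it makes `R` strictly smaller.
    R′≤N : ∣ R′ ∣ ≤ N
    R′≤N = s≤s⁻¹ (ℕ.≤-trans (p∩q≢∅⇒∣p─q∣<∣p∣ R J (i , x∈p∩q⁺ (J⊆R i∈J , i∈J))) R≤N)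

  k-wise-bound : Injective _≡_ _≡_ A → ∀ e (T : Subset n) R →
    (∀ {i} → i ∈ R → T ⊆ A i) → Intersecting (suc (suc e)) R →
    ∣ R ∣ ≤ suc e * binomSum ∣ ∁ T ∣ (length ls)
  k-wise-bound A-inj e T R T⊆A int with r , x , x∈R , tri , R≤ ← extract A-inj e ∣ R ∣ R ℕ.≤-refl int =
    ℕ.≤-trans R≤ (ℕ.*-monoʳ-≤ (suc e) (Triangular-bound T (λ j → T⊆A (x∈R j)) tri))

-- Binomial identities and growth of binomial sums

-- The absorption identity, by induction through Pascal's rule.
[k+1]*[n+1]C[k+1]≡[n+1]*nCk : ∀ n k → suc k * (suc n C suc k) ≡ suc n * (n C k)
[k+1]*[n+1]C[k+1]≡[n+1]*nCk n zero = begin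
  1 * (suc n C 1)    ≡⟨ ℕ.*-identityˡ _ ⟩
  suc n C 1          ≡⟨ nC1≡n (suc n) ⟩
  suc n              ≡⟨ ℕ.*-identityʳ (suc n) ⟨
  suc n * (n C 0)    ∎
  where open ≡-Reasoning
[k+1]*[n+1]C[k+1]≡[n+1]*nCk zero (suc k) = begin
  suc (suc k) * (1 C suc (suc k))  ≡⟨ cong (suc (suc k) *_) (k>n⇒nCk≡0 {1} {suc (suc k)} (s≤s (s≤s z≤n))) ⟩
  suc (suc k) * 0                  ≡⟨ ℕ.*-zeroʳ (suc (suc k)) ⟩
  0                                ≡⟨ cong (1 *_) (k>n⇒nCk≡0 {0} {suc k} (s≤s z≤n)) ⟨
  1 * (0 C suc k)                  ∎
  where open ≡-Reasoning
[k+1]*[n+1]C[k+1]≡[n+1]*nCk (suc n) (suc k) = begin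
  suc (suc k) * (suc (suc n) C suc (suc k))
    ≡⟨ cong (suc (suc k) *_) (nCk+nC[k+1]≡[n+1]C[k+1] (suc n) (suc k)) ⟨
  suc (suc k) * (x + (suc n C suc (suc k)))
    ≡⟨ expand k x (suc n C suc (suc k)) ⟩
  x + (suc k * x + suc (suc k) * (suc n C suc (suc k)))
    ≡⟨ cong (x +_) (cong₂ _+_ ([k+1]*[n+1]C[k+1]≡[n+1]*nCk n k) ([k+1]*[n+1]C[k+1]≡[n+1]*nCk n (suc k))) ⟩
  x + (suc n * (n C k) + suc n * (n C suc k))
    ≡⟨ cong (x +_) (ℕ.*-distribˡ-+ (suc n) (n C k) (n C suc k)) ⟨
  x + suc n * ((n C k) + (n C suc k))
    ≡⟨ cong (λ z → x + suc n * z) (nCk+nC[k+1]≡[n+1]C[k+1] n k) ⟩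
  suc (suc n) * x ∎
  where
  open ≡-Reasoning
  x = suc n C suc k
  expand : ∀ k x y → suc (suc k) * (x + y) ≡ x + (suc k * x + suc (suc k) * y)
  expand = ℕ-Solver.solve-∀

nCk≤[n+1]Ck : ∀ n k → n C k ≤ suc n C k
nCk≤[n+1]Ck n zero    = ℕ.≤-refl
nCk≤[n+1]Ck n (suc k) = ℕ.≤-trans (ℕ.m≤n+m _ (n C k)) (ℕ.≤-reflexive (nCk+nC[k+1]≡[n+1]C[k+1] n k))

C-monoˡ-≤ : ∀ k {m n} → m ≤ n → m C k ≤ n C k
C-monoˡ-≤ k m≤n = go (ℕ.≤⇒≤′ m≤n)
  where
  go : ∀ {m n} → m ℕ.≤′ n → m C k ≤ n C k
  go ℕ.≤′-refl        = ℕ.≤-refl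
  go (ℕ.≤′-step m≤′n) = ℕ.≤-trans (go m≤′n) (nCk≤[n+1]Ck _ k)

1≤binomSum : ∀ N s → 1 ≤ binomSum N s
1≤binomSum N zero    = ℕ.≤-refl
1≤binomSum N (suc s) = ℕ.≤-trans (1≤binomSum N s) (ℕ.m≤n+m _ (N C suc s))

-- Term by term: by absorption C(N + 1, j + 1) is (N + 1)/(j + 1) times C(N, j), and for j ≤ t the
-- hypothesis makes this ratio at least c.
binomSum-growth : ∀ c t N → (c + 1) * suc t ≤ suc N → c * binomSum N t ≤ binomSum (suc N) (suc t)
binomSum-growth c zero    N c≤N = begin
  c * 1                       ≤⟨ ℕ.*-monoˡ-≤ 1 (ℕ.m≤m+n c 1) ⟩
  (c + 1) * 1                 ≤⟨ c≤N ⟩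
  suc N                       ≡⟨ nC1≡n (suc N) ⟨
  suc N C 1                   ≤⟨ ℕ.m≤m+n _ 1 ⟩
  (suc N C 1) + 1             ∎
  where open ℕ.≤-Reasoning
binomSum-growth c (suc t) N c≤N = begin
  c * ((N C suc t) + binomSum N t)
    ≡⟨ ℕ.*-distribˡ-+ c (N C suc t) (binomSum N t) ⟩
  c * (N C suc t) + c * binomSum N t
    -- The top terms are compared after multiplication by t + 2, which clears the denominator in the
    -- ratio.
    ≤⟨ ℕ.+-mono-≤ (ℕ.*-cancelˡ-≤ {c * (N C suc t)} {suc N C suc (suc t)} (suc (suc t)) top)
         (binomSum-growth c t N (ℕ.≤-trans (ℕ.*-monoʳ-≤ (c + 1) (ℕ.n≤1+n (suc t))) c≤N)) ⟩
  (suc N C suc (suc t)) + binomSum (suc N) (suc t) ∎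
  where
  open ℕ.≤-Reasoning
  top : suc (suc t) * (c * (N C suc t)) ≤ suc (suc t) * (suc N C suc (suc t))
  top = begin
    suc (suc t) * (c * (N C suc t))         ≡⟨ ℕ.*-assoc (suc (suc t)) c (N C suc t) ⟨
    suc (suc t) * c * (N C suc t)           ≡⟨ cong (_* (N C suc t)) (ℕ.*-comm (suc (suc t)) c) ⟩
    c * suc (suc t) * (N C suc t)           ≤⟨ ℕ.*-monoˡ-≤ (N C suc t) (ℕ.*-monoˡ-≤ (suc (suc t)) (ℕ.m≤m+n c 1)) ⟩
    (c + 1) * suc (suc t) * (N C suc t)     ≤⟨ ℕ.*-monoˡ-≤ (N C suc t) c≤N ⟩
    suc N * (N C suc t)                     ≡⟨ [k+1]*[n+1]C[k+1]≡[n+1]*nCk N (suc t) ⟨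
    suc (suc t) * (suc N C suc (suc t))     ∎

-- Subsets of prescribed size and unions of families

All-subsetsOfSize : ∀ {n} q (p : Subset n) → All (λ S → ∣ S ∣ ≡ q) (subsetsOfSize q p)
All-subsetsOfSize zero    []            = refl ∷ []
All-subsetsOfSize (suc q) []            = []
All-subsetsOfSize zero    (outside ∷ p) = All.map⁺ (All-subsetsOfSize zero p)
All-subsetsOfSize (suc q) (outside ∷ p) = All.map⁺ (All-subsetsOfSize (suc q) p)
All-subsetsOfSize zero    (inside ∷ p)  = All.map⁺ (All-subsetsOfSize zero p)
All-subsetsOfSize (suc q) (inside ∷ p)  =
  All.++⁺ (All.map⁺ (All.map (cong suc) (All-subsetsOfSize q p))) (All.map⁺ (All-subsetsOfSize (suc q) p))

subset-of-size : ∀ {n} q (p : Subset n) → q ≤ ∣ p ∣ → ∃ λ S → S ⊆ p × ∣ S ∣ ≡ q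
subset-of-size {n} zero p q≤ = ⊥ , ⊥⊆ , ∣⊥∣≡0 n
subset-of-size (suc q) (outside ∷ p) q≤ =
  let S , S⊆p , ∣S∣≡q = subset-of-size (suc q) p q≤ in outside ∷ S , out⊆ S⊆p , ∣S∣≡q
subset-of-size (suc q) (inside ∷ p)  q≤ =
  let S , S⊆p , ∣S∣≡q = subset-of-size q p (s≤s⁻¹ q≤) in inside ∷ S , in⊆in S⊆p , cong suc ∣S∣≡q

-- Complement an (n - q)-subset of `∁ p`; `q ≤ n` makes the double truncated subtraction return `q`.
superset-of-size : ∀ {n} q (p : Subset n) → ∣ p ∣ ≤ q → q ≤ n → ∃ λ S → p ⊆ S × ∣ S ∣ ≡ q
superset-of-size {n} q p p≤q q≤n =
  let S , S⊆∁p , ∣S∣≡ = subset-of-size (n ∸ q) (∁ p)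
        (ℕ.≤-trans (ℕ.∸-monoʳ-≤ n p≤q) (ℕ.≤-reflexive (sym (∣∁p∣≡n∸∣p∣ p))))
  in ∁ S , (λ x∈p → x∉p⇒x∈∁p λ x∈S → x∈∁p⇒x∉p (S⊆∁p x∈S) x∈p) ,
     trans (∣∁p∣≡n∸∣p∣ S) (trans (cong (n ∸_) ∣S∣≡) (ℕ.m∸[m∸n]≡n q≤n))

⊆⋃-tabulate : ∀ {n k} (B : Fin k → Subset n) i → B i ⊆ ⋃ (tabulate B)
⊆⋃-tabulate B zero    = p⊆p∪q (⋃ (tabulate (B ∘ suc)))
⊆⋃-tabulate B (suc i) = q⊆p∪q (B zero) (⋃ (tabulate (B ∘ suc))) ∘ ⊆⋃-tabulate (B ∘ suc) i

∣⋃-tabulate∣≤ : ∀ {n} k {h} (B : Fin k → Subset n) → (∀ i → ∣ B i ∣ ≤ h) → ∣ ⋃ (tabulate B) ∣ ≤ k * h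
∣⋃-tabulate∣≤ {n} zero B B≤ = ℕ.≤-reflexive (∣⊥∣≡0 n)
∣⋃-tabulate∣≤ (suc k) B B≤ = ℕ.≤-trans
  (∣p∪q∣≤∣p∣+∣q∣ (B zero) (⋃ (tabulate (B ∘ suc))))
  (ℕ.+-mono-≤ (B≤ zero) (∣⋃-tabulate∣≤ k (B ∘ suc) (B≤ ∘ suc)))

∣A∣≤maxSize : ∀ {n m} (A : Fin m → Subset n) i → ∣ A i ∣ ≤ maxSize A
∣A∣≤maxSize A zero    = ℕ.m≤m⊔n ∣ A zero ∣ (maxSize (A ∘ suc))
∣A∣≤maxSize A (suc i) = ℕ.≤-trans (∣A∣≤maxSize (A ∘ suc) i) (ℕ.m≤n⊔m ∣ A zero ∣ (maxSize (A ∘ suc)))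

-- Here `q` bounds the excess of `meet A J` over the total meet. While some `A i` fails to contain
-- the current meet, adjoining `i` loses at least one point; once none fails, the current meet lies
-- in the total one. Hence at most `q` indices are added.
shrink-meet : ∀ {n m} (A : Fin m → Subset n) q J → ∣ meet A J ∣ ≤ q + ∣ meet A ⊤ ∣ →
  ∃ λ K → J ⊆ K × ∣ K ∣ ≤ q + ∣ J ∣ × ∣ meet A K ∣ ≤ ∣ meet A ⊤ ∣
shrink-meet A zero    J J≤ = J , ⊆-refl , ℕ.≤-refl , J≤
shrink-meet A (suc q) J J≤ with any? (λ i → ¬? (meet A J ⊆? A i))
... | no  ∄i = J , ⊆-refl , ℕ.m≤n+m ∣ J ∣ (suc q) ,
  p⊆q⇒∣p∣≤∣q∣ (⊆meet A ⊤ λ {i} _ → decidable-stable (meet A J ⊆? A i) λ J⊈Ai → ∄i (i , J⊈Ai))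
... | yes (i , J⊈Ai) =
  let K , J∪i⊆K , K≤ , meetK≤ = shrink-meet A q (J ∪ ⁅ i ⁆) (s≤s⁻¹ (ℕ.<-≤-trans smaller J≤))
  in K , J∪i⊆K ∘ p⊆p∪q ⁅ i ⁆
   , ℕ.≤-trans K≤ (ℕ.≤-trans (ℕ.+-monoʳ-≤ q (∣p∪⁅x⁆∣≤1+∣p∣ J i)) (ℕ.≤-reflexive (ℕ.+-suc q ∣ J ∣)))
   , meetK≤
  where
  smaller : ∣ meet A (J ∪ ⁅ i ⁆) ∣ < ∣ meet A J ∣
  smaller = ℕ.≰⇒> λ J≤J∪i → J⊈Ai
    (meet⊆ A (J ∪ ⁅ i ⁆) (q⊆p∪q J ⁅ i ⁆ (x∈⁅x⁆ i)) ∘ p⊆q∧∣q∣≤∣p∣⇒q⊆p (meet-antitone A (p⊆p∪q ⁅ i ⁆)) J≤J∪i)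

meet-size : ∀ {n m k s} (A : Fin m → Subset n) (L : Fin s → ℕ) →
  (∀ (f : Fin k → Fin m) → Injective _≡_ _≡_ f → ∃ λ i → ∣ interOf A f ∣ ≡ L i) →
  ∀ J → ∣ J ∣ ≡ k → ∃ λ i → ∣ meet A J ∣ ≡ L i
meet-size A L hyp J refl with f , f-inj , eq ← meet≡interOf A J =
  let i , eq′ = hyp f f-inj in i , trans (cong ∣_∣ (sym eq)) eq′

-- Families with and without a common l-subset

-- The parameters encode k = e + 2 and s = t + 1, so the least size `L zero` always exists.
module _ {n m} (A : Fin m → Subset n) (A-inj : Injective _≡_ _≡_ A) (e t : ℕ) (L : Fin (suc t) → ℕ)
  (L-mono : ∀ {i j} → Data.Fin._<_ i j → L i < L j)
  (meet∈L : ∀ J → ∣ J ∣ ≡ suc (suc e) → ∃ λ i → ∣ meet A J ∣ ≡ L i) where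

  private
    k : ℕ
    k = suc (suc e)
    l = L zero
    h = maxSize A

  l≤L : ∀ i → l ≤ L i
  l≤L zero    = ℕ.≤-refl
  l≤L (suc i) = ℕ.<⇒≤ (L-mono (s≤s z≤n))

  -- With at least k indices available, i and j extend to a k-set `J`, whose meet has a size in the
  -- list and lies inside both sets. The case i = j is included.
  l≤∣A∩A∣ : k ≤ m → ∀ i j → l ≤ ∣ A i ∩ A j ∣
  l≤∣A∩A∣ k≤m i j =
    let J , ij⊆J , ∣J∣≡k = superset-of-size k (⁅ i ⁆ ∪ ⁅ j ⁆) ∣ij∣≤k k≤m
        d , eq = meet∈L J ∣J∣≡k
    in begin
      l                ≤⟨ l≤L d ⟩
      L d              ≡⟨ eq ⟨
      ∣ meet A J ∣     ≤⟨ p⊆q⇒∣p∣≤∣q∣ (λ x∈ → x∈p∩q⁺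
                            ( meet⊆ A J (ij⊆J (p⊆p∪q ⁅ j ⁆ (x∈⁅x⁆ i))) x∈
                            , meet⊆ A J (ij⊆J (q⊆p∪q ⁅ i ⁆ ⁅ j ⁆ (x∈⁅x⁆ j))) x∈ )) ⟩
      ∣ A i ∩ A j ∣    ∎
    where
    open ℕ.≤-Reasoning
    ∣ij∣≤k : ∣ ⁅ i ⁆ ∪ ⁅ j ⁆ ∣ ≤ k
    ∣ij∣≤k = begin
      ∣ ⁅ i ⁆ ∪ ⁅ j ⁆ ∣     ≤⟨ ∣p∪⁅x⁆∣≤1+∣p∣ ⁅ i ⁆ j ⟩
      suc ∣ ⁅ i ⁆ ∣         ≡⟨ cong suc (∣⁅x⁆∣≡1 i) ⟩
      2                     ≤⟨ s≤s (s≤s z≤n) ⟩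
      k                     ∎

  -- Any l points of the total meet serve as `T`, whose complement has n - l points.
  bound-common : l ≤ ∣ meet A ⊤ ∣ → m ≤ suc e * binomSum (n ∸ l) (suc t)
  bound-common l≤ with T , T⊆ , ∣T∣≡l ← subset-of-size l (meet A ⊤) l≤ = begin
    m                                                     ≡⟨ ∣⊤∣≡n m ⟨
    ∣ ⊤ {m} ∣                                             ≤⟨ k-wise-bound A (tabulate L) A-inj e T ⊤
                                                               (λ i∈ → meet⊆ A ⊤ i∈ ∘ T⊆) int ⟩
    suc e * binomSum ∣ ∁ T ∣ (length (tabulate L))        ≡⟨ cong (suc e *_) (cong₂ binomSum
                                                               (trans (∣∁p∣≡n∸∣p∣ T) (cong (n ∸_) ∣T∣≡l)) (length-tabulate L)) ⟩
    suc e * binomSum (n ∸ l) (suc t)                      ∎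
    where
    open ℕ.≤-Reasoning
    int : Intersecting A (tabulate L) k ⊤
    int J _ ∣J∣≡k = let i , eq = meet∈L J ∣J∣≡k in subst (_∈ˡ tabulate L) (sym eq) (∈-tabulate⁺ {f = L} i)

  containing : Subset n → Subset m
  containing U = comprehension (λ i → U ⊆? A i)

  -- Meets of sets containing U are larger than l, so l drops out of the list of admissible sizes.
  bound-containing : ∀ U → ∣ U ∣ ≡ suc l → ∣ containing U ∣ ≤ suc e * binomSum (n ∸ suc l) t
  bound-containing U ∣U∣≡ = begin
    ∣ containing U ∣
      ≤⟨ k-wise-bound A (tabulate (L ∘ suc)) A-inj e U (containing U) (∈-comprehension⁻ (λ i → U ⊆? A i)) int ⟩
    suc e * binomSum ∣ ∁ U ∣ (length (tabulate (L ∘ suc)))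
      ≡⟨ cong (suc e *_) (cong₂ binomSum (trans (∣∁p∣≡n∸∣p∣ U) (cong (n ∸_) ∣U∣≡)) (length-tabulate (L ∘ suc))) ⟩
    suc e * binomSum (n ∸ suc l) t ∎
    where
    open ℕ.≤-Reasoning
    int : Intersecting A (tabulate (L ∘ suc)) k (containing U)
    int J J⊆ ∣J∣≡k with meet∈L J ∣J∣≡k
    ... | suc i , eq = subst (_∈ˡ tabulate (L ∘ suc)) (sym eq) (∈-tabulate⁺ {f = L ∘ suc} i)
    ... | zero  , eq = contradiction
      (subst (_≤ ∣ meet A J ∣) ∣U∣≡ (p⊆q⇒∣p∣≤∣q∣ (⊆meet A J λ j∈J → ∈-comprehension⁻ (λ i → U ⊆? A i) (J⊆ j∈J))))
      (ℕ.<⇒≱ (s≤s (ℕ.≤-reflexive eq)))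

  -- `Y` is the union of at most h + 1 members whose meet is already smaller than l. Each `A i`
  -- shares at least l points with each of them; were `A i ∩ Y` no larger than l, these shared
  -- points would be the same for all, and would lie in that meet.
  transversal : k ≤ m → ∣ meet A ⊤ ∣ < l → ∃ λ Y → ∣ Y ∣ ≤ h * h + h × (∀ i → l < ∣ A i ∩ Y ∣)
  transversal k≤m ⊤<l
    with i₀ ← fromℕ< (ℕ.<-≤-trans (s≤s z≤n) k≤m)
    with J , i₀⊆J , J≤ , J-meet ← shrink-meet A h ⁅ i₀ ⁆
           -- Starting from one set of size at most h, the excess over the total meet is at most h,
           -- so at most h indices join `i₀`.
           (ℕ.≤-trans (ℕ.≤-reflexive (cong ∣_∣ (meet-⁅⁆ A i₀)))
             (ℕ.≤-trans (∣A∣≤maxSize A i₀) (ℕ.m≤m+n h ∣ meet A ⊤ ∣)))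
    with f , _ , f∈J , f-onto ← enumerate J
    = Y , Y≤ , λ i → ℕ.≰⇒> (∣Ai∩Y∣≰l i)
    where
    open ℕ.≤-Reasoning
    Y = ⋃ (tabulate (A ∘ f))
    Y≤ : ∣ Y ∣ ≤ h * h + h
    Y≤ = begin
      ∣ Y ∣                         ≤⟨ ∣⋃-tabulate∣≤ ∣ J ∣ (A ∘ f) (∣A∣≤maxSize A ∘ f) ⟩
      ∣ J ∣ * h                     ≤⟨ ℕ.*-monoˡ-≤ h J≤ ⟩
      (h + ∣ ⁅ i₀ ⁆ ∣) * h          ≡⟨ cong (λ z → (h + z) * h) (∣⁅x⁆∣≡1 i₀) ⟩
      (h + 1) * h                   ≡⟨ cong (_* h) (ℕ.+-comm h 1) ⟩
      h + h * h                     ≡⟨ ℕ.+-comm h (h * h) ⟩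
      h * h + h                     ∎
    A⊆Y : ∀ {j} → j ∈ J → A j ⊆ Y
    A⊆Y j∈J with d , refl ← f-onto j∈J = ⊆⋃-tabulate (A ∘ f) d
    A∩A⊆ : ∀ i {j} → j ∈ J → A i ∩ A j ⊆ A i ∩ Y
    A∩A⊆ i {j} j∈J x∈ = x∈p∩q⁺ (p∩q⊆p (A i) (A j) x∈ , A⊆Y j∈J (p∩q⊆q (A i) (A j) x∈))
    -- Otherwise A i ∩ Y = A i ∩ A j for every j ∈ J, so that meet A J contains it.
    ∣Ai∩Y∣≰l : ∀ i → ¬ (∣ A i ∩ Y ∣ ≤ l)
    ∣Ai∩Y∣≰l i A∩Y≤l = ℕ.<⇒≱ ⊤<l (begin
      l                    ≤⟨ l≤∣A∩A∣ k≤m i i₀ ⟩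
      ∣ A i ∩ A i₀ ∣       ≤⟨ p⊆q⇒∣p∣≤∣q∣ (A∩A⊆ i (i₀⊆J (x∈⁅x⁆ i₀))) ⟩
      ∣ A i ∩ Y ∣          ≤⟨ p⊆q⇒∣p∣≤∣q∣ (⊆meet A J λ {j} j∈J →
                                p∩q⊆q (A i) (A j) ∘ p⊆q∧∣q∣≤∣p∣⇒q⊆p (A∩A⊆ i j∈J)
                                  (ℕ.≤-trans A∩Y≤l (l≤∣A∩A∣ k≤m i j))) ⟩
      ∣ meet A J ∣         ≤⟨ J-meet ⟩
      ∣ meet A ⊤ ∣         ∎)

  -- Each `A i` contains some (l + 1)-subset `U` of `Y` and so is counted in `containing U`; the
  -- bound sums over all such `U`.
  bound-cover : ∀ Y → (∀ i → l < ∣ A i ∩ Y ∣) → m ≤ (∣ Y ∣ C suc l) * (suc e * binomSum (n ∸ suc l) t)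
  bound-cover Y l<A∩Y = begin
    m                                                       ≡⟨ ∣⊤∣≡n m ⟨
    ∣ ⊤ {m} ∣                                               ≤⟨ p⊆q⇒∣p∣≤∣q∣ {p = ⊤} (λ {i} _ → covered i) ⟩
    ∣ ⋃ (tabulate (containing ∘ lookup Us)) ∣               ≤⟨ ∣⋃-tabulate∣≤ (length Us) (containing ∘ lookup Us)
                                                                 (λ d → bound-containing (lookup Us d)
                                                                   (All.lookup (All-subsetsOfSize (suc l) Y) (∈-lookup d))) ⟩
    length Us * (suc e * binomSum (n ∸ suc l) t)            ≡⟨ cong (_* (suc e * binomSum (n ∸ suc l) t))
                                                                 (length-subsetsOfSize (suc l) Y) ⟩
    (∣ Y ∣ C suc l) * (suc e * binomSum (n ∸ suc l) t)      ∎
    where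
    open ℕ.≤-Reasoning
    Us = subsetsOfSize (suc l) Y
    covered : ∀ i → i ∈ ⋃ (tabulate (containing ∘ lookup Us))
    covered i with U , U⊆ , ∣U∣≡ ← subset-of-size (suc l) (A i ∩ Y) (l<A∩Y i) =
      ⊆⋃-tabulate (containing ∘ lookup Us) (index U∈)
        (∈-comprehension⁺ (λ i → lookup Us (index U∈) ⊆? A i)
          (subst (_⊆ A i) (lookup-index U∈) (p∩q⊆p (A i) Y ∘ U⊆)))
      where
      U∈ : U ∈ˡ Us
      U∈ = subst (λ q → U ∈ˡ subsetsOfSize q Y) ∣U∣≡ (∈-subsetsOfSize (p∩q⊆q (A i) Y ∘ U⊆))

  bound-no-common : k ≤ m → ∣ meet A ⊤ ∣ < l → (((h * h + h) C suc l) + 1) * suc t + l ≤ n →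
    m ≤ suc e * binomSum (n ∸ l) (suc t)
  bound-no-common k≤m ⊤<l n≥ with Y , Y≤ , l<A∩Y ← transversal k≤m ⊤<l = begin
    m                                                   ≤⟨ bound-cover Y l<A∩Y ⟩
    (∣ Y ∣ C suc l) * (suc e * binomSum (n ∸ suc l) t)  ≤⟨ ℕ.*-monoˡ-≤ _ (C-monoˡ-≤ (suc l) Y≤) ⟩
    c * (suc e * binomSum (n ∸ suc l) t)                ≡⟨ ℕ.*-assoc c (suc e) _ ⟨
    c * suc e * binomSum (n ∸ suc l) t                  ≡⟨ cong (_* binomSum (n ∸ suc l) t) (ℕ.*-comm c (suc e)) ⟩
    suc e * c * binomSum (n ∸ suc l) t                  ≡⟨ ℕ.*-assoc (suc e) c _ ⟩
    suc e * (c * binomSum (n ∸ suc l) t)                ≤⟨ ℕ.*-monoʳ-≤ (suc e) growth ⟩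
    suc e * binomSum (n ∸ l) (suc t)                    ∎
    where
    open ℕ.≤-Reasoning
    c = (h * h + h) C suc l
    N≥ : (c + 1) * suc t ≤ n ∸ l
    N≥ = ℕ.m+n≤o⇒m≤o∸n ((c + 1) * suc t) n≥
    -- The product (c + 1)(t + 1) is at least 1, so n ≥ l + 1 and the subtraction is not truncated.
    n∸l≡ : suc (n ∸ suc l) ≡ n ∸ l
    n∸l≡ = sym (ℕ.+-∸-assoc 1 (ℕ.≤-trans
      (ℕ.+-monoˡ-≤ l (ℕ.*-mono-≤ (ℕ.m≤n+m 1 c) (s≤s (z≤n {t})))) n≥))
    growth : c * binomSum (n ∸ suc l) t ≤ binomSum (n ∸ l) (suc t)
    growth = subst (λ N → c * binomSum (n ∸ suc l) t ≤ binomSum N (suc t)) n∸l≡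
      (binomSum-growth c t (n ∸ suc l) (subst ((c + 1) * suc t ≤_) (sym n∸l≡) N≥))

theorem3p5 : (k : ℕ) → 2 ≤ k → (t : ℕ) → (L : Fin (suc t) → ℕ) →
    (∀ {i j} → Data.Fin._<_ i j → L i < L j) →
    (n m : ℕ) → (A : Fin m → Subset n) → Injective _≡_ _≡_ A →
    (∀ (f : Fin k → Fin m) → Injective _≡_ _≡_ f → ∃ λ i → ∣ interOf A f ∣ ≡ L i) →
    (((maxSize A * maxSize A + maxSize A) C suc (L zero)) + 1) * suc t + L zero ≤ n →
    m ≤ (k ∸ 1) * binomSum (n ∸ L zero) (suc t)
theorem3p5 (suc (suc e)) (s≤s (s≤s z≤n)) t L L-mono n m A A-inj hyp n≥
  with suc (suc e) ℕ.≤? m | L zero ℕ.≤? ∣ meet A ⊤ ∣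
... | yes _   | yes l≤ = bound-common A A-inj e t L L-mono (meet-size A L hyp) l≤
... | yes k≤m | no  l≰ = bound-no-common A A-inj e t L L-mono (meet-size A L hyp) k≤m (ℕ.≰⇒> l≰) n≥
-- With fewer than k sets, m ≤ k - 1, and the binomial sum is at least its last term C(n - l₁, 0) =
-- 1.
... | no  k≰m | _      = begin
  m                                           ≤⟨ s≤s⁻¹ (ℕ.≰⇒> k≰m) ⟩
  suc e                                       ≡⟨ ℕ.*-identityʳ (suc e) ⟨
  suc e * 1                                   ≤⟨ ℕ.*-monoʳ-≤ (suc e) (1≤binomSum (n ∸ L zero) (suc t)) ⟩
  suc e * binomSum (n ∸ L zero) (suc t)       ∎
  where open ℕ.≤-Reasoning
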